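{- For every integer $d\ge 4$, the cube hypergraph $Q^3_d$ is loose Hamilton connected: for any two distinct vertices $a,b\in\{0,1,2\}^d$ there exists a loose path in $Q^3_d$ from $a$ to $b$ containing every vertex of $Q^3_d$.
   Context: For $d\in\mathbb{N}_0$, the cube hypergraph $Q^3_d$ is the $3$-uniform hypergraph with vertex set $V_d=\{0,1,2\}^d$ whose edges are all unordered triples $\{u,v,w\}$ of pairwise distinct sequences that agree in $d-1$ of the $d$ coordinates (so in the remaining coordinate they take the three values $0,1,2$). A loose path of length $\ell\in\mathbb{N}_0$ in a $3$-uniform hypergraph consists of a sequence of distinct vertices $v_0,v_1,\dots,v_{2\ell}$ and a sequence of distinct edges $e_1,\dots,e_\ell$ with $e_i=\{v_{2i-2},v_{2i-1},v_{2i}\}$ for $i\in\{1,\dots,\ell\}$; it is a loose path from $v_0$ to $v_{2\ell}$. A hypergraph is loose Hamilton connected if for any two distinct vertices $a,b$ there is a loose path from $a$ to $b$ containing all vertices. -}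

module Defs where

open import Data.Nat using (ℕ; suc; _+_; _*_)
open import Data.Fin using (Fin; zero; suc; toℕ; fromℕ; fromℕ<)
open import Data.Fin.Properties using (toℕ<n)
open import Data.Nat using (_<_; _≤_; s≤s)
open import Data.Nat.Properties using (+-comm; ≤-reflexive; *-suc; ≤-trans; +-monoʳ-≤; *-monoʳ-≤; ≤-pred)
open import Data.Vec using (Vec; lookup)
open import Data.Product using (Σ; _×_; ∃; ∃-syntax)
open import Data.Sum using (_⊎_)
open import Relation.Binary.PropositionalEquality using (_≡_; sym; trans)
open import Relation.Nullary using (¬_)
open import Function.Definitions using (Injective; Surjective)

V : ℕ → Set
V d = Vec (Fin 3) d

-- {u,v,w} is an edge of Q^3_d: pairwise distinct and agreeing in all
-- coordinates except (at most, hence exactly) one coordinate i.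
IsEdge : (d : ℕ) → V d → V d → V d → Set
IsEdge d u v w =
  ¬ u ≡ v × ¬ v ≡ w × ¬ u ≡ w ×
  ∃[ i ] (∀ (j : Fin d) → ¬ j ≡ i →
            (lookup u j ≡ lookup v j × lookup v j ≡ lookup w j))

-- An unordered triple, represented by three vertices.
record Triple (d : ℕ) : Set where
  constructor ⟨_,_,_⟩
  field
    t₀ t₁ t₂ : V d

_∈T_ : {d : ℕ} → V d → Triple d → Set
x ∈T ⟨ a , b , c ⟩ = x ≡ a ⊎ x ≡ b ⊎ x ≡ c

_≈T_ : {d : ℕ} → Triple d → Triple d → Set
s ≈T t = (∀ x → x ∈T s → x ∈T t) × (∀ x → x ∈T t → x ∈T s)

-- The position 2i+k (k ∈ {0,1,2}) in Fin (2ℓ+1), for i : Fin ℓ.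
-- Edge e_{i+1} (paper's 1-based indexing) is {v_{2i}, v_{2i+1}, v_{2i+2}}.
pos : {ℓ : ℕ} → (k : Fin 3) → Fin ℓ → Fin (suc (2 * ℓ))
pos {ℓ} k i = fromℕ< (bound k i)
  where
  bound : ∀ {ℓ} (k : Fin 3) (i : Fin ℓ) → 2 * toℕ i + toℕ k < suc (2 * ℓ)
  bound {ℓ} k i = s≤s (≤-trans (+-monoʳ-≤ (2 * toℕ i) (≤-pred (toℕ<n k)))
                     (≤-trans (≤-reflexive (trans (+-comm (2 * toℕ i) 2) (sym (*-suc 2 (toℕ i)))))
                              (*-monoʳ-≤ 2 (toℕ<n i))))

edgeAt : {d ℓ : ℕ} → (Fin (suc (2 * ℓ)) → V d) → Fin ℓ → Triple d
edgeAt v i = ⟨ v (pos zero i) , v (pos (suc zero) i) , v (pos (suc (suc zero)) i) ⟩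

record LoosePath (d ℓ : ℕ) : Set where
  field
    vtx      : Fin (suc (2 * ℓ)) → V d
    vtx-inj  : Injective _≡_ _≡_ vtx
    edges-ok : ∀ (i : Fin ℓ) →
                 IsEdge d (vtx (pos zero i)) (vtx (pos (suc zero) i))
                          (vtx (pos (suc (suc zero)) i))
    edges-distinct : ∀ (i j : Fin ℓ) → edgeAt vtx i ≈T edgeAt vtx j → i ≡ j

open LoosePath public

start end : {d ℓ : ℕ} → LoosePath d ℓ → V d
start P = vtx P zero
end {d} {ℓ} P = vtx P (fromℕ (2 * ℓ))

Spanning : {d ℓ : ℕ} → LoosePath d ℓ → Set
Spanning {d} P = ∀ (x : V d) → ∃[ k ] vtx P k ≡ x

LooseHamiltonConnected : ℕ → Set
LooseHamiltonConnected d =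
  ∀ (a b : V d) → ¬ a ≡ b →
    ∃[ ℓ ] Σ (LoosePath d ℓ) (λ P → start P ≡ a × end P ≡ b × Spanning P)

{-# OPTIONS --safe #-}
module Submission where

-- Induction on the dimension, splitting the cube into three copies by the first coordinate.
-- By parity, Hamilton paths of the copies cannot be glued directly, so we carry along vertex-disjoint systems
-- of loose paths which cover everything except a few deleted vertices.
--
-- Filling: interrupt a path from s to t twice, as s … o₁, o₂ … o₃, o₄ … t, inside copy i.  In the next dimension
-- the interruptions are bridged by a path o₁ … o₂ through copy j and a path o₃ … o₄ through copy k.  Each bridging
-- edge has its middle vertex in the third copy, so the detour in copy j must avoid o₃, o₄ and that in copy k must
-- avoid o₁, o₂.  If the detour in copy j is itself interrupted, so is the result, and the process can be repeated.
--
-- Crossing: if the endpoints lie in different copies i and j, a path visits the copies in the order i, j, i, k, j.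
-- Relative to a fixed 4-tuple x this needs a departure {a … x₁, x₂ … x₃} avoiding x₄ in copy i, a detour x₃ … x₄
-- avoiding x₁, x₂ in copy k, and an arrival {x₁ … x₂, x₄ … b} avoiding x₃ in copy j.  Arrivals themselves cross
-- between copies: a transfer leads from the tuple x to another tuple y, where a lower-dimensional arrival takes over.
--
-- Everything thus reduces to finitely many path systems in dimension four, found by computer search.
-- A coordinatewise relabelling reduces to paths from 0…0 to a point of {0,1}^d.

open import Defs
import Algebra.Solver.CommutativeMonoid as CommutativeMonoidSolver
open import Data.Bool using (Bool; true; false; not; T; if_then_else_)
open import Data.Fin using (Fin; zero; suc; toℕ; fromℕ<; punchOut; combine; remQuot)
open import Data.Fin.Patterns using (0F; 1F; 2F; 3F)
open import Data.Fin.Properties using (_≟_; all?; any?; toℕ-fromℕ<; toℕ-fromℕ; toℕ<n; toℕ-injective; punchOut-injective; injective⇒≤; combine-remQuot)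
open import Data.List using (List; []; _∷_; _++_; map; length)
open import Data.List.Membership.Propositional using (_∈_)
open import Data.List.Membership.Propositional.Properties using (∈-map⁺; ∈-++⁺ˡ; ∈-++⁺ʳ)
open import Data.List.Properties using (length-map; length-++; map-++; ++-identityʳ)
open import Data.List.Relation.Binary.Permutation.Propositional using (_↭_; ↭-refl)
open import Data.List.Relation.Binary.Permutation.Propositional.Properties using (∈-resp-↭; ↭-length; ++-commutativeMonoid)
open import Data.List.Relation.Unary.All using (All; []; _∷_)
open import Data.List.Relation.Unary.Any using (here; there)
open import Data.Maybe using (Maybe; just; nothing; is-just; to-witness-T; _>>=_)
open import Data.Nat using (ℕ; zero; suc; _+_; _*_; _∸_; _^_; _≤_; _<_; z≤n; s≤s; _≡ᵇ_)
open import Data.Nat.DivMod using (_/_; _%_; _mod_)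
open import Data.Nat.Properties using (*-comm; +-identityʳ; +-comm; 1+n≰n; even≢odd; *-cancelˡ-≡; suc-injective; m∸n+n≡m) renaming (_≟_ to _≟ⁿ_)
open import Data.Product using (Σ; _×_; _,_; proj₁; proj₂; ∃-syntax; uncurry)
open import Data.Sum using (_⊎_; inj₁; inj₂)
open import Data.Unit using (tt)
open import Data.Vec using (Vec; []; _∷_; lookup; replicate; updateAt)
import Data.Vec as Vec
open import Data.Vec.Properties using (∷-injective; ∷-injectiveˡ; ∷-injectiveʳ; ≡-dec)
open import Function using (_∘_)
open import Function.Definitions using (Injective)
open import Relation.Binary.PropositionalEquality using (_≡_; _≢_; refl; sym; trans; cong; cong₂; subst; subst₂)
open import Relation.Nullary using (yes; no; does; contradiction)
open import Relation.Nullary.Decidable using (toWitness; _→-dec_)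

private
  variable
    d : ℕ
    a b c m s t : V d

-- Walks along edges and their vertex lists.

data Walk {d : ℕ} : V d → V d → Set where
  stop : Walk a a
  step : IsEdge d a m c → Walk c b → Walk a b

verts : Walk a b → List (V _)
verts {a = a} stop = a ∷ []
verts {a = a} (step {m = m} _ w) = a ∷ m ∷ verts w

size : {a b : V d} → Walk a b → ℕ
size stop = 0
size (step _ w) = suc (size w)

bridge : Walk a b → IsEdge d b m c → Walk c t → Walk a t
bridge stop e w′ = step e w′
bridge (step f w) e w′ = step f (bridge w e w′)

verts-bridge : (w : Walk a b) (e : IsEdge d b m c) (w′ : Walk c t) →
               verts (bridge w e w′) ≡ verts w ++ m ∷ verts w′
verts-bridge stop e w′ = refl
verts-bridge (step {m = n} f w) e w′ = cong (λ ws → _ ∷ n ∷ ws) (verts-bridge w e w′)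

module _ {d d′ : ℕ} (f : V d → V d′)
         (f-edge : ∀ {a m c} → IsEdge d a m c → IsEdge d′ (f a) (f m) (f c)) where

  mapWalk : Walk a b → Walk (f a) (f b)
  mapWalk stop = stop
  mapWalk (step e w) = step (f-edge e) (mapWalk w)

  verts-mapWalk : (w : Walk a b) → verts (mapWalk w) ≡ map f (verts w)
  verts-mapWalk stop = refl
  verts-mapWalk (step e w) = cong (λ ws → _ ∷ _ ∷ ws) (verts-mapWalk w)

-- Lists exhausting the cube, and the pigeonhole principle.

-- The length condition stands for the absence of repetitions, which it implies by pigeonhole.
Full : List (V d) → Set
Full {d} xs = (∀ x → x ∈ xs) × length xs ≡ 3 ^ d

Full-resp-↭ : {xs ys : List (V d)} → xs ↭ ys → Full xs → Full ys
Full-resp-↭ p (all , len) = (λ x → ∈-resp-↭ p (all x)) , trans (sym (↭-length p)) len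

-- Ternary digits of an index: an injection into the cube for the counting argument.
enumerate : (d : ℕ) → Fin (3 ^ d) → V d
enumerate zero _ = []
enumerate (suc d) z = proj₁ (remQuot {3} (3 ^ d) z) ∷ enumerate d (proj₂ (remQuot {3} (3 ^ d) z))

enumerate-injective : (d : ℕ) → Injective _≡_ _≡_ (enumerate d)
enumerate-injective zero {zero} {zero} _ = refl
enumerate-injective (suc d) {y} {z} eq with ∷-injective eq
... | eq₁ , eq₂ = trans (sym (combine-remQuot {3} (3 ^ d) y))
                 (trans (cong₂ combine eq₁ (enumerate-injective d eq₂))
                        (combine-remQuot {3} (3 ^ d) z))

-- If `i` and `j` had the same value, `j` could replace `i`, so every vertex would have a preimage
-- other than `i`. Punching out `i` would then inject `3 ^ d`, that is `suc n`, indices into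
-- `Fin n`.
spanning⇒injective : {n : ℕ} (f : Fin n → V d) → n ≡ 3 ^ d → (∀ x → ∃[ k ] f k ≡ x) →
                     Injective _≡_ _≡_ f
spanning⇒injective {d} {suc n} f n≡ onto {i} {j} fi≡fj with i ≟ j
... | yes i≡j = i≡j
... | no  i≢j = contradiction (subst (_≤ n) (sym n≡) (injective⇒≤ short-injective)) 1+n≰n
  where
  pick : (x : V d) → ∃[ k ] (f k ≡ x × i ≢ k)
  pick x with onto x
  ... | k , fk≡x with i ≟ k
  ...   | no  i≢k = k , fk≡x , i≢k
  ...   | yes refl = j , trans (sym fi≡fj) fk≡x , i≢j

  short : Fin (3 ^ d) → Fin n
  short z = punchOut (proj₂ (proj₂ (pick (enumerate d z))))

  short-injective : Injective _≡_ _≡_ short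
  short-injective {y} {z} eq with pick (enumerate d y) | pick (enumerate d z)
  ... | k , fk , i≢k | l , fl , i≢l =
    enumerate-injective d (trans (sym fk) (trans (cong f (punchOut-injective i≢k i≢l eq)) fl))

-- From covering walks to loose Hamilton paths.

-- Beyond the end the value is the final vertex. Positions are written `i * 2` because `suc i * 2`
-- reduces to two successors, as in the last clause.
at : {a b : V d} → Walk a b → ℕ → V d
at {a = a} stop _ = a
at {a = a} (step _ _) 0 = a
at (step {m = m} _ _) 1 = m
at (step _ w) (suc (suc n)) = at w n

at-start : (w : Walk a b) → at w 0 ≡ a
at-start stop = refl
at-start (step _ _) = refl

at-end : (w : Walk a b) → at w (size w * 2) ≡ b
at-end stop = refl
at-end (step _ w) = at-end w

at-edge : (w : Walk {d} a b) {i : ℕ} → i < size w →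
          IsEdge d (at w (i * 2)) (at w (1 + i * 2)) (at w (2 + i * 2))
at-edge (step e w) {zero} _ = subst (IsEdge _ _ _) (sym (at-start w)) e
at-edge (step _ w) {suc i} (s≤s i<) = at-edge w i<

∈-verts⇒at : (w : Walk {d} a b) {x : V d} → x ∈ verts w → ∃[ n ] (n < suc (size w * 2) × at w n ≡ x)
∈-verts⇒at stop (here refl) = 0 , s≤s z≤n , refl
∈-verts⇒at (step _ w) (here refl) = 0 , s≤s z≤n , refl
∈-verts⇒at (step _ w) (there (here refl)) = 1 , s≤s (s≤s z≤n) , refl
∈-verts⇒at (step _ w) (there (there x∈)) with ∈-verts⇒at w x∈
... | n , n< , eq = suc (suc n) , s≤s (s≤s n<) , eq

length-verts : (w : Walk {d} a b) → length (verts w) ≡ suc (size w * 2)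
length-verts stop = refl
length-verts (step _ w) = cong (2 +_) (length-verts w)

module _ {a b : V d} (w : Walk a b) (full : Full (verts w)) where

  private
    ℓ = size w

    v : Fin (suc (2 * ℓ)) → V d
    v k = at w (toℕ k)

    toℕ-pos : (k : Fin 3) (i : Fin ℓ) → toℕ (pos k i) ≡ toℕ k + toℕ i * 2
    toℕ-pos k i = trans (toℕ-fromℕ< _) (trans (+-comm (2 * toℕ i) (toℕ k)) (cong (toℕ k +_) (*-comm 2 (toℕ i))))

    v-pos : (k : Fin 3) (i : Fin ℓ) → v (pos k i) ≡ at w (toℕ k + toℕ i * 2)
    v-pos k i = cong (at w) (toℕ-pos k i)

    v-onto : ∀ x → ∃[ k ] v k ≡ x
    v-onto x with ∈-verts⇒at w (proj₁ full x)
    ... | n , n< , eq = fromℕ< n<′ , trans (cong (at w) (toℕ-fromℕ< n<′)) eq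
      where n<′ = subst (n <_) (cong suc (*-comm ℓ 2)) n<

    v-injective : Injective _≡_ _≡_ v
    v-injective = spanning⇒injective v
      (trans (cong suc (*-comm 2 ℓ)) (trans (sym (length-verts w)) (proj₂ full))) v-onto

    v-edge : (i : Fin ℓ) → IsEdge d (v (pos zero i)) (v (pos (suc zero) i)) (v (pos (suc (suc zero)) i))
    v-edge i rewrite v-pos zero i | v-pos (suc zero) i | v-pos (suc (suc zero)) i = at-edge w (toℕ<n i)

    -- An edge is recognised by its middle vertex, the only one at an odd position.
    middle-owner : (i j : Fin ℓ) (k : Fin 3) → v (pos (suc zero) i) ≡ v (pos k j) → i ≡ j
    middle-owner i j k eq with trans (sym (toℕ-pos (suc zero) i)) (trans (cong toℕ (v-injective eq)) (toℕ-pos k j))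
    middle-owner i j zero _ | eq = contradiction (trans (*-comm 2 (toℕ j)) (trans (sym eq) (cong suc (*-comm (toℕ i) 2)))) (even≢odd (toℕ j) (toℕ i))
    middle-owner i j (suc zero) _ | eq = toℕ-injective (*-cancelˡ-≡ _ _ 2 (trans (*-comm 2 (toℕ i)) (trans (suc-injective eq) (*-comm (toℕ j) 2))))
    middle-owner i j (suc (suc zero)) _ | eq = contradiction (trans (*-comm 2 (suc (toℕ j))) (trans (sym eq) (cong suc (*-comm (toℕ i) 2)))) (even≢odd (suc (toℕ j)) (toℕ i))

    v-edges-distinct : (i j : Fin ℓ) → edgeAt v i ≈T edgeAt v j → i ≡ j
    v-edges-distinct i j (i⊆j , _) with i⊆j (v (pos (suc zero) i)) (inj₂ (inj₁ refl))
    ... | inj₁ eq = middle-owner i j zero eq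
    ... | inj₂ (inj₁ eq) = middle-owner i j (suc zero) eq
    ... | inj₂ (inj₂ eq) = middle-owner i j (suc (suc zero)) eq

  fullWalk⇒hamiltonPath : ∃[ ℓ ] Σ (LoosePath d ℓ) (λ P → start P ≡ a × end P ≡ b × Spanning P)
  fullWalk⇒hamiltonPath = ℓ
    , record { vtx = v ; vtx-inj = v-injective ; edges-ok = v-edge ; edges-distinct = v-edges-distinct }
    , at-start w
    , trans (cong (at w) (trans (toℕ-fromℕ (2 * ℓ)) (*-comm 2 ℓ))) (at-end w)
    , v-onto

-- Systems of disjoint walks.

Pairs : ℕ → Set
Pairs d = List (V d × V d)

allVerts : {ps : Pairs d} → All (uncurry Walk) ps → List (V d)
allVerts [] = []
allVerts (w ∷ ws) = verts w ++ allVerts ws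

-- Walks joining the pairs ps which, together with the single vertices ds, partition the cube.
record System (d : ℕ) (ps : Pairs d) (ds : List (V d)) : Set where
  constructor system
  field
    walks : All (uncurry Walk) ps
    full  : Full (allVerts walks ++ ds)

-- The three copies of the cube, named cyclically.

next : Fin 3 → Fin 3
next zero = suc zero
next (suc zero) = suc (suc zero)
next (suc (suc zero)) = zero

≢-next : (i : Fin 3) → i ≢ next i
≢-next zero ()
≢-next (suc zero) ()
≢-next (suc (suc zero)) ()

≢-next² : (i : Fin 3) → i ≢ next (next i)
≢-next² zero ()
≢-next² (suc zero) ()
≢-next² (suc (suc zero)) ()

next-exhausts : (i c : Fin 3) → c ≡ i ⊎ c ≡ next i ⊎ c ≡ next (next i)
next-exhausts zero zero = inj₁ refl
next-exhausts zero (suc zero) = inj₂ (inj₁ refl)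
next-exhausts zero (suc (suc zero)) = inj₂ (inj₂ refl)
next-exhausts (suc zero) zero = inj₂ (inj₂ refl)
next-exhausts (suc zero) (suc zero) = inj₁ refl
next-exhausts (suc zero) (suc (suc zero)) = inj₂ (inj₁ refl)
next-exhausts (suc (suc zero)) zero = inj₂ (inj₁ refl)
next-exhausts (suc (suc zero)) (suc zero) = inj₂ (inj₂ refl)
next-exhausts (suc (suc zero)) (suc (suc zero)) = inj₁ refl

rung : {i j k : Fin 3} → i ≢ j → j ≢ k → i ≢ k → (x : V d) → IsEdge (suc d) (i ∷ x) (j ∷ x) (k ∷ x)
rung i≢j j≢k i≢k x = i≢j ∘ ∷-injectiveˡ , j≢k ∘ ∷-injectiveˡ , i≢k ∘ ∷-injectiveˡ , zero
  , λ { zero 0≢0 → contradiction refl 0≢0 ; (suc _) _ → refl , refl }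

∷-edge : (i : Fin 3) → IsEdge d a m c → IsEdge (suc d) (i ∷ a) (i ∷ m) (i ∷ c)
∷-edge i (a≢m , m≢c , a≢c , n , agree) = a≢m ∘ ∷-injectiveʳ , m≢c ∘ ∷-injectiveʳ , a≢c ∘ ∷-injectiveʳ , suc n
  , λ { zero _ → refl , refl ; (suc j) j≢n → agree j (j≢n ∘ cong suc) }

lift : (i : Fin 3) → Walk a b → Walk (i ∷ a) (i ∷ b)
lift i = mapWalk (i ∷_) (∷-edge i)

liftPairs : Fin 3 → Pairs d → Pairs (suc d)
liftPairs i = map (λ (s , t) → i ∷ s , i ∷ t)

liftAll : (i : Fin 3) {ps : Pairs d} → All (uncurry Walk) ps → All (uncurry Walk) (liftPairs i ps)
liftAll i [] = []
liftAll i (w ∷ ws) = lift i w ∷ liftAll i ws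

allVerts-liftAll : (i : Fin 3) {ps : Pairs d} (ws : All (uncurry Walk) ps) →
                   allVerts (liftAll i ws) ≡ map (i ∷_) (allVerts ws)
allVerts-liftAll i [] = refl
allVerts-liftAll i (w ∷ ws) =
  trans (cong₂ _++_ (verts-mapWalk (i ∷_) (∷-edge i) w) (allVerts-liftAll i ws))
        (sym (map-++ (i ∷_) (verts w) (allVerts ws)))

-- The walks are lifted one by one, so that the vertex list of each lifted walk can be an atom for
-- the monoid solver.
layer : (i : Fin 3) {ps : Pairs d} {ds : List (V d)} → System d ps ds → List (V (suc d))
layer i {ds = ds} (system ws _) = allVerts (liftAll i ws) ++ map (i ∷_) ds

module _ (i : Fin 3) {ps₀ ps₁ ps₂ : Pairs d} {ds₀ ds₁ ds₂ : List (V d)}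
         (X : System d ps₀ ds₀) (Y : System d ps₁ ds₁) (Z : System d ps₂ ds₂) where

  private
    layer≡map : (j : Fin 3) {ps : Pairs d} {ds : List (V d)} (A : System d ps ds) →
                layer j A ≡ map (j ∷_) (allVerts (System.walks A) ++ ds)
    layer≡map j {ds = ds} (system ws _) =
      trans (cong (_++ map (j ∷_) ds) (allVerts-liftAll j ws)) (sym (map-++ (j ∷_) (allVerts ws) ds))

    ∈-layer : (j : Fin 3) {ps : Pairs d} {ds : List (V d)} (A : System d ps ds) (x : V d) → j ∷ x ∈ layer j A
    ∈-layer j A x = subst (_ ∈_) (sym (layer≡map j A)) (∈-map⁺ (j ∷_) (proj₁ (System.full A) x))

    length-layer : (j : Fin 3) {ps : Pairs d} {ds : List (V d)} (A : System d ps ds) → length (layer j A) ≡ 3 ^ d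
    length-layer j A = trans (cong length (layer≡map j A)) (trans (length-map (j ∷_) (allVerts (System.walks A) ++ _)) (proj₂ (System.full A)))

  -- Each layer is the lifted image of a full list, so it contains its whole copy, and the three
  -- lengths add up to `3 ^ suc d`.
  layers-full : Full (layer i X ++ layer (next i) Y ++ layer (next (next i)) Z)
  layers-full = onto , len
    where
    onto : ∀ x → x ∈ layer i X ++ layer (next i) Y ++ layer (next (next i)) Z
    onto (c ∷ x) with next-exhausts i c
    ... | inj₁ refl = ∈-++⁺ˡ (∈-layer c X x)
    ... | inj₂ (inj₁ refl) = ∈-++⁺ʳ (layer i X) (∈-++⁺ˡ (∈-layer c Y x))
    ... | inj₂ (inj₂ refl) = ∈-++⁺ʳ (layer i X) (∈-++⁺ʳ (layer (next i) Y) (∈-layer c Z x))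

    len : length (layer i X ++ layer (next i) Y ++ layer (next (next i)) Z) ≡ 3 ^ suc d
    len = trans (length-++ (layer i X)) (cong₂ _+_ (length-layer i X)
         (trans (length-++ (layer (next i) Y)) (cong₂ _+_ (length-layer (next i) Y)
         (trans (length-layer (next (next i)) Z) (sym (+-identityʳ (3 ^ d)))))))

-- Gluing systems across the copies.

module _ (i : Fin 3) where

  private
    j = next i
    k = next j

    i≢j : i ≢ j
    i≢j = ≢-next i
    j≢k : j ≢ k
    j≢k = ≢-next j
    i≢k : i ≢ k
    i≢k = ≢-next² i

    ikj : (x : V d) → IsEdge (suc d) (i ∷ x) (k ∷ x) (j ∷ x)
    ikj = rung i≢k (j≢k ∘ sym) i≢j
    jki : (x : V d) → IsEdge (suc d) (j ∷ x) (k ∷ x) (i ∷ x)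
    jki = rung j≢k (i≢k ∘ sym) (i≢j ∘ sym)
    ijk : (x : V d) → IsEdge (suc d) (i ∷ x) (j ∷ x) (k ∷ x)
    ijk = rung i≢j j≢k i≢k
    kji : (x : V d) → IsEdge (suc d) (k ∷ x) (j ∷ x) (i ∷ x)
    kji = rung (j≢k ∘ sym) (i≢j ∘ sym) (i≢k ∘ sym)
    kij : (x : V d) → IsEdge (suc d) (k ∷ x) (i ∷ x) (j ∷ x)
    kij = rung (i≢k ∘ sym) i≢j (j≢k ∘ sym)

  module _ {d : ℕ} {ps : Pairs d} {ds : List (V d)} where
    open CommutativeMonoidSolver (++-commutativeMonoid {A = V (suc d)}) using (solve; _⊜_; _⊕_; id)

    -- The new path visits the copies in the order `i`, `j`, `i`, `k`, `i`. The bridges at `o₁`,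
    -- `o₂` have their middle vertices in copy `k`, those at `o₃`, `o₄` in copy `j`: exactly the
    -- vertices deleted from `Z` and `Y`.
    fill : (o₁ o₂ o₃ o₄ : V d) {s t : V d} →
           System d ((o₄ , t) ∷ (s , o₁) ∷ (o₂ , o₃) ∷ ps) ds →
           System d ((o₁ , o₂) ∷ []) (o₃ ∷ o₄ ∷ []) →
           System d ((o₃ , o₄) ∷ []) (o₁ ∷ o₂ ∷ []) →
           System (suc d) ((i ∷ s , i ∷ t) ∷ liftPairs i ps) (map (i ∷_) ds)
    fill o₁ o₂ o₃ o₄ X@(system (w₄ ∷ w₁ ∷ w₂ ∷ ws) _) Y@(system (y ∷ []) _) Z@(system (z ∷ []) _) =
      system (w ∷ liftAll i ws) (subst Full (sym verts-w) (Full-resp-↭ rearrange (layers-full i X Y Z)))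
      where
      A B C D E P S : List (V (suc d))
      A = verts (lift i w₁)
      B = verts (lift j y)
      C = verts (lift i w₂)
      D = verts (lift k z)
      E = verts (lift i w₄)
      P = allVerts (liftAll i ws)
      S = map (i ∷_) ds

      u₃ = bridge (lift k z) (kji o₄) (lift i w₄)
      u₂ = bridge (lift i w₂) (ijk o₃) u₃
      u₁ = bridge (lift j y) (jki o₂) u₂
      w  = bridge (lift i w₁) (ikj o₁) u₁

      new : List (V (suc d))
      new = ((A ++ (k ∷ o₁) ∷ B ++ (k ∷ o₂) ∷ C ++ (j ∷ o₃) ∷ D ++ (j ∷ o₄) ∷ E) ++ P) ++ S

      verts-w : (verts w ++ P) ++ S ≡ new
      verts-w rewrite verts-bridge (lift i w₁) (ikj o₁) u₁
                    | verts-bridge (lift j y) (jki o₂) u₂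
                    | verts-bridge (lift i w₂) (ijk o₃) u₃
                    | verts-bridge (lift k z) (kji o₄) (lift i w₄) = refl

      rearrange : layer i X ++ layer j Y ++ layer k Z ↭ new
      -- The blocks are the five walk pieces, the other walks, the vertices still deleted, and the
      -- four middle vertices of the bridges; `id` is the empty tail of a one-walk list. Both sides
      -- have the same normal form, hence reflexivity.
      rearrange = solve 11
        (λ a b c d e p s k₁ k₂ j₃ j₄ →
          ((e ⊕ (a ⊕ (c ⊕ p))) ⊕ s) ⊕ (((b ⊕ id) ⊕ (j₃ ⊕ j₄)) ⊕ ((d ⊕ id) ⊕ (k₁ ⊕ k₂)))
          ⊜ (((a ⊕ (k₁ ⊕ (b ⊕ (k₂ ⊕ (c ⊕ (j₃ ⊕ (d ⊕ (j₄ ⊕ e)))))))) ⊕ p) ⊕ s))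
        ↭-refl A B C D E P S ((k ∷ o₁) ∷ []) ((k ∷ o₂) ∷ []) ((j ∷ o₃) ∷ []) ((j ∷ o₄) ∷ [])

    -- As in `fill`, but the detour through copy `j` is itself cut at the `q`s, which become the
    -- interruption of the new path. The result has the shape of `X` again, so the construction
    -- iterates.
    refill : (o₁ o₂ o₃ o₄ q₁ q₂ q₃ q₄ : V d) {s t : V d} →
             System d ((o₄ , t) ∷ (s , o₁) ∷ (o₂ , o₃) ∷ ps) ds →
             System d ((q₄ , o₂) ∷ (o₁ , q₁) ∷ (q₂ , q₃) ∷ []) (o₃ ∷ o₄ ∷ []) →
             System d ((o₃ , o₄) ∷ []) (o₁ ∷ o₂ ∷ []) →
             System (suc d) ((next i ∷ q₄ , i ∷ t) ∷ (i ∷ s , next i ∷ q₁) ∷ (next i ∷ q₂ , next i ∷ q₃) ∷ liftPairs i ps)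
                            (map (i ∷_) ds)
    refill o₁ o₂ o₃ o₄ q₁ q₂ q₃ q₄
           X@(system (w₄ ∷ w₁ ∷ w₂ ∷ ws) _) Y@(system (y₄ ∷ y₁ ∷ y₂ ∷ []) _) Z@(system (z ∷ []) _) =
      system (v ∷ u ∷ lift j y₂ ∷ liftAll i ws)
             (subst Full (sym verts-vu) (Full-resp-↭ rearrange (layers-full i X Y Z)))
      where
      A B₁ B₂ B₄ C D E P S : List (V (suc d))
      A  = verts (lift i w₁)
      B₁ = verts (lift j y₁)
      B₂ = verts (lift j y₂)
      B₄ = verts (lift j y₄)
      C  = verts (lift i w₂)
      D  = verts (lift k z)
      E  = verts (lift i w₄)
      P  = allVerts (liftAll i ws)
      S  = map (i ∷_) ds

      u  = bridge (lift i w₁) (ikj o₁) (lift j y₁)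
      v₂ = bridge (lift k z) (kji o₄) (lift i w₄)
      v₁ = bridge (lift i w₂) (ijk o₃) v₂
      v  = bridge (lift j y₄) (jki o₂) v₁

      new : List (V (suc d))
      new = ((B₄ ++ (k ∷ o₂) ∷ C ++ (j ∷ o₃) ∷ D ++ (j ∷ o₄) ∷ E) ++ (A ++ (k ∷ o₁) ∷ B₁) ++ B₂ ++ P) ++ S

      verts-vu : (verts v ++ verts u ++ B₂ ++ P) ++ S ≡ new
      verts-vu rewrite verts-bridge (lift i w₁) (ikj o₁) (lift j y₁)
                     | verts-bridge (lift j y₄) (jki o₂) v₁
                     | verts-bridge (lift i w₂) (ijk o₃) v₂
                     | verts-bridge (lift k z) (kji o₄) (lift i w₄) = refl

      rearrange : layer i X ++ layer j Y ++ layer k Z ↭ new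
      rearrange = solve 13
        (λ a b₁ b₂ b₄ c d e p s k₁ k₂ j₃ j₄ →
          ((e ⊕ (a ⊕ (c ⊕ p))) ⊕ s) ⊕ (((b₄ ⊕ (b₁ ⊕ (b₂ ⊕ id))) ⊕ (j₃ ⊕ j₄)) ⊕ ((d ⊕ id) ⊕ (k₁ ⊕ k₂)))
          ⊜ (((b₄ ⊕ (k₂ ⊕ (c ⊕ (j₃ ⊕ (d ⊕ (j₄ ⊕ e)))))) ⊕ ((a ⊕ (k₁ ⊕ b₁)) ⊕ (b₂ ⊕ p))) ⊕ s))
        ↭-refl A B₁ B₂ B₄ C D E P S ((k ∷ o₁) ∷ []) ((k ∷ o₂) ∷ []) ((j ∷ o₃) ∷ []) ((j ∷ o₄) ∷ [])

    -- The deleted `o₄` in copy `i` and `o₃` in copy `j` are the middle vertices of the bridges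
    -- `kij o₄` and `ijk o₃`. The pairs `ps` stay in copy `i`, so that arrivals and interrupted
    -- paths can cross as well.
    cross : (o₁ o₂ o₃ o₄ : V d) {s t : V d} →
            System d ((s , o₁) ∷ (o₂ , o₃) ∷ ps) (o₄ ∷ ds) →
            System d ((o₄ , t) ∷ (o₁ , o₂) ∷ []) (o₃ ∷ []) →
            System d ((o₃ , o₄) ∷ []) (o₁ ∷ o₂ ∷ []) →
            System (suc d) ((i ∷ s , next i ∷ t) ∷ liftPairs i ps) (map (i ∷_) ds)
    cross o₁ o₂ o₃ o₄ X@(system (w₁ ∷ w₂ ∷ ws) _) Y@(system (y₄ ∷ y₁ ∷ []) _) Z@(system (z ∷ []) _) =
      system (w ∷ liftAll i ws) (subst Full (sym verts-w) (Full-resp-↭ rearrange (layers-full i X Y Z)))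
      where
      A B C D E P S : List (V (suc d))
      A = verts (lift i w₁)
      B = verts (lift j y₁)
      C = verts (lift i w₂)
      D = verts (lift k z)
      E = verts (lift j y₄)
      P = allVerts (liftAll i ws)
      S = map (i ∷_) ds

      u₃ = bridge (lift k z) (kij o₄) (lift j y₄)
      u₂ = bridge (lift i w₂) (ijk o₃) u₃
      u₁ = bridge (lift j y₁) (jki o₂) u₂
      w  = bridge (lift i w₁) (ikj o₁) u₁

      new : List (V (suc d))
      new = ((A ++ (k ∷ o₁) ∷ B ++ (k ∷ o₂) ∷ C ++ (j ∷ o₃) ∷ D ++ (i ∷ o₄) ∷ E) ++ P) ++ S

      verts-w : (verts w ++ P) ++ S ≡ new
      verts-w rewrite verts-bridge (lift i w₁) (ikj o₁) u₁
                    | verts-bridge (lift j y₁) (jki o₂) u₂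
                    | verts-bridge (lift i w₂) (ijk o₃) u₃
                    | verts-bridge (lift k z) (kij o₄) (lift j y₄) = refl

      rearrange : layer i X ++ layer j Y ++ layer k Z ↭ new
      rearrange = solve 11
        (λ a b c d e p s k₁ k₂ j₃ i₄ →
          ((a ⊕ (c ⊕ p)) ⊕ (i₄ ⊕ s)) ⊕ (((e ⊕ (b ⊕ id)) ⊕ j₃) ⊕ ((d ⊕ id) ⊕ (k₁ ⊕ k₂)))
          ⊜ (((a ⊕ (k₁ ⊕ (b ⊕ (k₂ ⊕ (c ⊕ (j₃ ⊕ (d ⊕ (i₄ ⊕ e)))))))) ⊕ p) ⊕ s))
        ↭-refl A B C D E P S ((k ∷ o₁) ∷ []) ((k ∷ o₂) ∷ []) ((j ∷ o₃) ∷ []) ((i ∷ o₄) ∷ [])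

-- When an interrupted path crosses, only its last piece, listed first, changes copy. The walk from
-- the second to the third crossing vertex is moved next to it; the other two pieces of the path
-- join the remaining pairs.
rotate : {e₁ e₂ e₃ e₄ : V d × V d} {ps : Pairs d} {ds : List (V d)} →
         System d (e₁ ∷ e₂ ∷ e₃ ∷ e₄ ∷ ps) ds → System d (e₁ ∷ e₄ ∷ e₂ ∷ e₃ ∷ ps) ds
rotate {d} {ds = ds} (system (w₁ ∷ w₂ ∷ w₃ ∷ w₄ ∷ ws) full) =
  system (w₁ ∷ w₄ ∷ w₂ ∷ w₃ ∷ ws) (Full-resp-↭ rearrange full)
  where
  open CommutativeMonoidSolver (++-commutativeMonoid {A = V d}) using (solve; _⊜_; _⊕_)
  rearrange : allVerts (w₁ ∷ w₂ ∷ w₃ ∷ w₄ ∷ ws) ++ ds ↭ allVerts (w₁ ∷ w₄ ∷ w₂ ∷ w₃ ∷ ws) ++ ds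
  rearrange = solve 6 (λ a b c e f s → (a ⊕ (b ⊕ (c ⊕ (e ⊕ f)))) ⊕ s ⊜ (a ⊕ (e ⊕ (b ⊕ (c ⊕ f)))) ⊕ s)
    ↭-refl (verts w₁) (verts w₂) (verts w₃) (verts w₄) (allVerts ws) ds

-- Certificates and their verification.

Move : ℕ → Set
Move d = Fin d × Bool

turn : Bool → Fin 3 → Fin 3
turn false = next
turn true  = next ∘ next

turn-edge : (n : Fin d) (σ : Bool) (x : V d) →
            IsEdge d x (updateAt x n (turn σ)) (updateAt x n (turn (not σ)))
turn-edge zero false (i ∷ x) = rung (≢-next i) (≢-next (next i)) (≢-next² i) x
turn-edge zero true  (i ∷ x) = rung (≢-next² i) (≢-next (next i) ∘ sym) (≢-next i) x
turn-edge (suc n) σ (i ∷ x) = ∷-edge i (turn-edge n σ x)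

trace : (s t : V d) → List (Move d) → Maybe (Walk s t × List (Move d))
trace s t ms with ≡-dec _≟_ s t
-- A walk ends on first reaching its target, so the encoding carries no lengths; the moves left over
-- serve the following walks.
trace s .s ms              | yes refl = just (stop , ms)
trace s t []               | no _ = nothing
trace s t ((n , σ) ∷ ms)   | no _ = do
  (w , ms′) ← trace (updateAt s n (turn (not σ))) t ms
  just (step (turn-edge n σ s) w , ms′)

traceAll : (ps : Pairs d) → List (Move d) → Maybe (All (uncurry Walk) ps)
traceAll [] ms = just []
traceAll ((s , t) ∷ ps) ms = do
  (w , ms′) ← trace s t ms
  ws ← traceAll ps ms′
  just (w ∷ ws)

slice : Fin 3 → List (V (suc d)) → List (V d)
slice i [] = []
slice i ((c ∷ x) ∷ xs) = if does (c ≟ i) then x ∷ slice i xs else slice i xs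

∈-slice : (i : Fin 3) (xs : List (V (suc d))) {y : V d} → y ∈ slice i xs → i ∷ y ∈ xs
∈-slice i ((c ∷ x) ∷ xs) y∈ with c ≟ i
∈-slice i ((c ∷ x) ∷ xs) (here refl) | yes refl = here refl
∈-slice i ((c ∷ x) ∷ xs) (there y∈)  | yes refl = there (∈-slice i xs y∈)
... | no _ = there (∈-slice i xs y∈)

-- Splitting by successive coordinates avoids searching the whole list once per vertex.
spans? : (xs : List (V d)) → Maybe (∀ x → x ∈ xs)
spans? {zero} [] = nothing
spans? {zero} ([] ∷ xs) = just λ { [] → here refl }
spans? {suc d} xs = do
  f ← spans? (slice 0F xs)
  g ← spans? (slice 1F xs)
  h ← spans? (slice 2F xs)
  just λ { (0F ∷ x) → ∈-slice 0F xs (f x) ; (1F ∷ x) → ∈-slice 1F xs (g x) ; (2F ∷ x) → ∈-slice 2F xs (h x) }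

full? : (xs : List (V d)) → Maybe (Full xs)
full? {d} xs with length xs ≟ⁿ 3 ^ d
... | no _ = nothing
... | yes len = do
  onto ← spans? xs
  just (onto , len)

-- An octal digit 2n + σ, least significant first, encodes the edge in direction n traversed in sense σ;
-- no system in the four-dimensional cube has more than 40 edges.
decode : ℕ → ℕ → List (Move 4)
decode zero _ = []
decode (suc fuel) n = ((n / 2) mod 4 , (n % 2 ≡ᵇ 1)) ∷ decode fuel (n / 8)

check : (ps : Pairs 4) (ds : List (V 4)) → ℕ → Maybe (System 4 ps ds)
check ps ds n = do
  -- `decode 40` always yields forty moves; any surplus after the last walk is dropped.
  ws ← traceAll ps (decode 40 n)
  f ← full? (allVerts ws ++ ds)
  just (system ws f)

-- For a concrete certificate the type of `ok` evaluates to the unit type, so `ok` is inferred and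
-- type checking performs the verification.
certified : {ps : Pairs 4} {ds : List (V 4)} (n : ℕ) {ok : T (is-just (check ps ds n))} → System 4 ps ds
certified {ps} {ds} n {ok} = to-witness-T (check ps ds n) ok

-- Anchors and the families of systems.

-- The labels are closed under interruption: by `detourGap₄`, each tuple in each orientation has a
-- detour interrupted at another tuple of the list.
data Label : Set where
  l₁ l₂ l₃ l₄ l₅ l₆ : Label

-- All these vertices have a coordinate 2, so that they never meet the endpoints in {0,1}^4.
tuple : Label → Vec (V 4) 4
tuple l₁ = (2F ∷ 0F ∷ 2F ∷ 0F ∷ []) ∷ (0F ∷ 2F ∷ 0F ∷ 0F ∷ []) ∷ (1F ∷ 2F ∷ 0F ∷ 0F ∷ []) ∷ (1F ∷ 2F ∷ 1F ∷ 2F ∷ []) ∷ []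
tuple l₂ = (0F ∷ 1F ∷ 0F ∷ 2F ∷ []) ∷ (2F ∷ 2F ∷ 0F ∷ 2F ∷ []) ∷ (0F ∷ 0F ∷ 0F ∷ 2F ∷ []) ∷ (2F ∷ 1F ∷ 1F ∷ 2F ∷ []) ∷ []
tuple l₃ = (0F ∷ 2F ∷ 2F ∷ 1F ∷ []) ∷ (0F ∷ 2F ∷ 1F ∷ 2F ∷ []) ∷ (2F ∷ 2F ∷ 2F ∷ 2F ∷ []) ∷ (0F ∷ 2F ∷ 1F ∷ 1F ∷ []) ∷ []
tuple l₄ = (1F ∷ 1F ∷ 1F ∷ 2F ∷ []) ∷ (0F ∷ 2F ∷ 1F ∷ 2F ∷ []) ∷ (1F ∷ 2F ∷ 2F ∷ 2F ∷ []) ∷ (0F ∷ 1F ∷ 1F ∷ 2F ∷ []) ∷ []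
tuple l₅ = (1F ∷ 0F ∷ 2F ∷ 1F ∷ []) ∷ (1F ∷ 2F ∷ 1F ∷ 1F ∷ []) ∷ (2F ∷ 1F ∷ 2F ∷ 1F ∷ []) ∷ (1F ∷ 0F ∷ 2F ∷ 0F ∷ []) ∷ []
tuple l₆ = (1F ∷ 1F ∷ 2F ∷ 2F ∷ []) ∷ (2F ∷ 1F ∷ 0F ∷ 0F ∷ []) ∷ (1F ∷ 2F ∷ 1F ∷ 2F ∷ []) ∷ (1F ∷ 2F ∷ 2F ∷ 2F ∷ []) ∷ []

opposite : Fin 4 → Fin 4
opposite 0F = 2F
opposite 1F = 3F
opposite 2F = 0F
opposite 3F = 1F

corner : Label → Bool → Fin 4 → V 4
corner l false n = lookup (tuple l) n
corner l true  n = lookup (tuple l) (opposite n)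

-- The flag exchanges the pairs (c₁ , c₂) and (c₃ , c₄).
Anchor : ℕ → Set
Anchor k = V k × Label × Bool

c₁ c₂ c₃ c₄ : {k : ℕ} → Anchor k → V (k + 4)
c₁ (x , l , f) = x Vec.++ corner l f 0F
c₂ (x , l , f) = x Vec.++ corner l f 1F
c₃ (x , l , f) = x Vec.++ corner l f 2F
c₄ (x , l , f) = x Vec.++ corner l f 3F

-- The pair (s , t) interrupted at an anchor: s runs to c₁, c₂ to c₃, and c₄ to t.
Gap : (k : ℕ) (s t : V (k + 4)) → Pairs (k + 4) → List (V (k + 4)) → Set
Gap k s t ps ds = Σ (Anchor k) λ o → System (k + 4) ((c₄ o , t) ∷ (s , c₁ o) ∷ (c₂ o , c₃ o) ∷ ps) ds

origin : (d : ℕ) → V d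
origin d = replicate d 0F

-- With an all-zero prefix, the vertices one dimension up are by computation the images of these in
-- copy `0F`, so lifted pairs match the next statement.
home : {k : ℕ} → Label → Anchor k
home l = origin _ , l , false

-- A transfer contains two tuples at once, which must be disjoint; two suffice, since successive
-- crossings alternate.
side : Bool → Label
side false = l₁
side true  = l₂

point : Vec Bool d → V d
point = Vec.map (λ β → if β then 1F else 0F)

-- Boolean-valued, so that the hypothesis for `false ∷ β` reduces to the one for `β`.
nonzero : Vec Bool d → Bool
nonzero [] = false
nonzero (true ∷ _) = true
nonzero (false ∷ β) = nonzero β

-- Each family comes whole and interrupted: within one copy, the interrupted form yields both forms
-- in the next dimension.
DetourSystem : {k : ℕ} → Anchor k → Set
DetourSystem {k} o = System (k + 4) ((c₁ o , c₂ o) ∷ []) (c₃ o ∷ c₄ o ∷ [])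

DetourGap : {k : ℕ} → Anchor k → Set
DetourGap {k} o = Gap k (c₁ o) (c₂ o) [] (c₃ o ∷ c₄ o ∷ [])

DepartureSystem DepartureGap : ℕ → Set
DepartureSystem k = System (k + 4) ((origin _ , c₁ x) ∷ (c₂ x , c₃ x) ∷ []) (c₄ x ∷ [])
  where x = home {k} l₁
DepartureGap k = Gap k (origin _) (c₁ x) ((c₂ x , c₃ x) ∷ []) (c₄ x ∷ [])
  where x = home {k} l₁

-- A departure towards `y` starting from `c₄ x`, together with the rest of an arrival at `x`: the
-- walk from `c₁ x` to `c₂ x` and the deleted `c₃ x`.
TransferSystem TransferGap : ℕ → Bool → Set
TransferSystem k h = System (k + 4) ((c₄ x , c₁ y) ∷ (c₂ y , c₃ y) ∷ (c₁ x , c₂ x) ∷ []) (c₄ y ∷ c₃ x ∷ [])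
  where x = home {k} (side h) ; y = home {k} (side (not h))
TransferGap k h = Gap k (c₄ x) (c₁ y) ((c₂ y , c₃ y) ∷ (c₁ x , c₂ x) ∷ []) (c₄ y ∷ c₃ x ∷ [])
  where x = home {k} (side h) ; y = home {k} (side (not h))

ArrivalSystem ArrivalGap : (k : ℕ) → Bool → Vec Bool (k + 4) → Set
ArrivalSystem k h β = System (k + 4) ((c₄ x , point β) ∷ (c₁ x , c₂ x) ∷ []) (c₃ x ∷ [])
  where x = home {k} (side h)
ArrivalGap k h β = Gap k (c₄ x) (point β) ((c₁ x , c₂ x) ∷ []) (c₃ x ∷ [])
  where x = home {k} (side h)

PathSystem PathGap : (k : ℕ) → Vec Bool (k + 4) → Set
PathSystem k β = System (k + 4) ((origin _ , point β) ∷ []) []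
PathGap k β = Gap k (origin _) (point β) [] []

-- Certified systems in dimension four.

detour₄ : (l : Label) (f : Bool) → DetourSystem ([] , l , f)
detour₄ l₁ false = certified 0x1debc771674fb9f315eb1ee85d518a
detour₄ l₁ true  = certified 0x555a3a547eaa788ae1ea8345d47d5
detour₄ l₂ false = certified 0x696275185e98a7a5e51199fb90716
detour₄ l₂ true  = certified 0xe65ce99441d7d18119eb86bd1e716
detour₄ l₃ false = certified 0x14b3a18fdc28660ecb8867a30e0719
detour₄ l₃ true  = certified 0x2abe866067071f616574315138ca0
detour₄ l₄ false = certified 0x1e7359732e750ccf10cb147bab2aca
detour₄ l₄ true  = certified 0x1a0984d038cdf055070c41971e639e
detour₄ l₅ false = certified 0x51be055f5195ae287a639eaa10ec2
detour₄ l₅ true  = certified 0xaa2a7395c19c198398b1ef9cf0a79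
detour₄ l₆ false = certified 0x1151e745579d5c311e70dd54f06717
detour₄ l₆ true  = certified 0x1c78f5c557a2e99a2a1c5c217d703

detourGap₄ : (l : Label) (f : Bool) → DetourGap ([] , l , f)
detourGap₄ l₁ false = ([] , l₃ , true) , certified 0x1ebd786e5e0be1429466a2eac50cc
detourGap₄ l₁ true  = ([] , l₂ , true) , certified 0x21d709a0e8282730be7a14b3460f3
detourGap₄ l₂ false = ([] , l₃ , true) , certified 0x4f15183f1c3353357470d7194d38
detourGap₄ l₂ true  = ([] , l₁ , false) , certified 0x31f15150574614420d563d79a3a18
detourGap₄ l₃ false = ([] , l₁ , true) , certified 0x1970f2ba8862ce0cfcb9d7047846e
detourGap₄ l₃ true  = ([] , l₂ , false) , certified 0x332ea2a7ae01c519f3746bb3a98f0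
detourGap₄ l₄ false = ([] , l₁ , false) , certified 0x39daf61528d4350a2ce09e282e860
detourGap₄ l₄ true  = ([] , l₁ , true) , certified 0x316622a3eab13d13bdc53a730ea8c
detourGap₄ l₅ false = ([] , l₂ , false) , certified 0x42c41c2f4cd1eebc15e74b1c43c5
detourGap₄ l₅ true  = ([] , l₂ , true) , certified 0x31f028cac10c850a845c3786789cf
detourGap₄ l₆ false = ([] , l₃ , true) , certified 0x2c5730ba08f7a67e64667cb8fa0bb
detourGap₄ l₆ true  = ([] , l₅ , true) , certified 0x3eae9c21ecbab085d1740ebc3aac5

departure₄ : DepartureSystem 0
departure₄ = certified 0x1ae7e73ae5e777c7433c42a3c7445d

departureGap₄ : DepartureGap 0
departureGap₄ = ([] , l₂ , true) , certified 0x2981f9c2a66a2b9a2c32c11afa146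

transfer₄ : (h : Bool) → TransferSystem 0 h
transfer₄ false = certified 0x19858cfc2852c5eaa2f3bca355ca2
transfer₄ true  = certified 0xb28bf42cc2d4210f9ce5a99d73af

transferGap₄ : (h : Bool) → TransferGap 0 h
transferGap₄ false = ([] , l₃ , false) , certified 0x2ac3c3c7698c510b19fa2be5f53a
transferGap₄ true  = ([] , l₃ , true) , certified 0x15af7e178e5ab3907d9be09e4f03

pattern O = false
pattern I = true

arrival₄ : (h : Bool) (β : Vec Bool 4) → ArrivalSystem 0 h β
arrival₄ false (O ∷ O ∷ O ∷ O ∷ []) = certified 0x1587af0fba8b9e08ef286716719e6e
arrival₄ false (O ∷ O ∷ O ∷ I ∷ []) = certified 0x151e320e0e15130d142abd708c2cea
arrival₄ false (O ∷ O ∷ I ∷ O ∷ []) = certified 0x1d47d437bd73a862a89ea9a9b8c2a6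
arrival₄ false (O ∷ O ∷ I ∷ I ∷ []) = certified 0x19f883be167d774470570590c10535
arrival₄ false (O ∷ I ∷ O ∷ O ∷ []) = certified 0x15e470879704f4c7ee3ee3afe205ce
arrival₄ false (O ∷ I ∷ O ∷ I ∷ []) = certified 0x1c23aa8545d4f153151e2ce20f3aba
arrival₄ false (O ∷ I ∷ I ∷ O ∷ []) = certified 0xcdd05e8f9c408c0b3135415e8a8c2
arrival₄ false (O ∷ I ∷ I ∷ I ∷ []) = certified 0x1af751759aae551a7c354d5d11d15d
arrival₄ false (I ∷ O ∷ O ∷ O ∷ []) = certified 0x1cc70e98f9d62ebc3dcf8d50717beb
arrival₄ false (I ∷ O ∷ O ∷ I ∷ []) = certified 0x1e338238af117a62fa9e2e75086655
arrival₄ false (I ∷ O ∷ I ∷ O ∷ []) = certified 0xca8c2cea0b286ba63a3842a9cb19e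
arrival₄ false (I ∷ O ∷ I ∷ I ∷ []) = certified 0xfaaf2291ef9cfc733c59a51f54f14
arrival₄ false (I ∷ I ∷ O ∷ O ∷ []) = certified 0x19799f356716716e6aec2af981cf5d
arrival₄ false (I ∷ I ∷ O ∷ I ∷ []) = certified 0x8f2c734708985f53d1185abd0def8
arrival₄ false (I ∷ I ∷ I ∷ O ∷ []) = certified 0x14ebdfb9fba1be281d7ae3ee7588a6
arrival₄ false (I ∷ I ∷ I ∷ I ∷ []) = certified 0xaa394139aab347b9e2a32a2c351a2
arrival₄ true  (O ∷ O ∷ O ∷ O ∷ []) = certified 0x13550dc2967b3cb143ee8c5e1e67c7
arrival₄ true  (O ∷ O ∷ O ∷ I ∷ []) = certified 0xf0f59c63a30705e3d65d478818eca
arrival₄ true  (O ∷ O ∷ I ∷ O ∷ []) = certified 0x1d07a745f519556bcdf262ccd55115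
arrival₄ true  (O ∷ O ∷ I ∷ I ∷ []) = certified 0x103acaec3a27ab1ccbe668f9cb1eb5
arrival₄ true  (O ∷ I ∷ O ∷ O ∷ []) = certified 0x6e866aa610a90accbab5e17460cb4
arrival₄ true  (O ∷ I ∷ O ∷ I ∷ []) = certified 0x1a3a58c54efd46e28e471550be2ecb
arrival₄ true  (O ∷ I ∷ I ∷ O ∷ []) = certified 0x7143515cef0eb4670ef167bd1742a
arrival₄ true  (O ∷ I ∷ I ∷ I ∷ []) = certified 0x1ef78f5a75a89a879c599c1e61e41f
arrival₄ true  (I ∷ O ∷ O ∷ O ∷ []) = certified 0xc614e28e08ebc6bd97070ef8e99cf
arrival₄ true  (I ∷ O ∷ O ∷ I ∷ []) = certified 0x5e61513866b2f9f7a0f30b330f2c5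
arrival₄ true  (I ∷ O ∷ I ∷ O ∷ []) = certified 0x1944678bb2abd27146ae8e68ec38b5
arrival₄ true  (I ∷ O ∷ I ∷ I ∷ []) = certified 0xf9cf9aee87d678739eefa55478982
arrival₄ true  (I ∷ I ∷ O ∷ O ∷ []) = certified 0x138d38710504c697592855445c7bcf
arrival₄ true  (I ∷ I ∷ O ∷ I ∷ []) = certified 0x13a2e9e29eb57d0716987b909bd13c
arrival₄ true  (I ∷ I ∷ I ∷ O ∷ []) = certified 0x1cfbdf10f314f5defde34ef05397dd
arrival₄ true  (I ∷ I ∷ I ∷ I ∷ []) = certified 0x55130a1f3a18e8fd72fb82311c18d

arrivalGap₄ : (h : Bool) (β : Vec Bool 4) → ArrivalGap 0 h β
arrivalGap₄ false (O ∷ O ∷ O ∷ O ∷ []) = ([] , l₄ , true) , certified 0x22d39ba8f78ba757513d620c5df04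
arrivalGap₄ false (O ∷ O ∷ O ∷ I ∷ []) = ([] , l₂ , false) , certified 0x3dc55d5958f99d11c17150287a338
arrivalGap₄ false (O ∷ O ∷ I ∷ O ∷ []) = ([] , l₅ , false) , certified 0x19772c17a22f0c544822c29420614
arrivalGap₄ false (O ∷ O ∷ I ∷ I ∷ []) = ([] , l₂ , false) , certified 0x219ce5ce868631873c5874211418d
arrivalGap₄ false (O ∷ I ∷ O ∷ O ∷ []) = ([] , l₃ , true) , certified 0x21ba3cc6987987b5e3ef535384d54
arrivalGap₄ false (O ∷ I ∷ O ∷ I ∷ []) = ([] , l₃ , true) , certified 0x21ba3cc6987987b5f3af5353c4f54
arrivalGap₄ false (O ∷ I ∷ I ∷ O ∷ []) = ([] , l₃ , true) , certified 0x195422297ce55ea8b9973deb82155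
arrivalGap₄ false (O ∷ I ∷ I ∷ I ∷ []) = ([] , l₂ , false) , certified 0x219ce5ce868631873c5854211418d
arrivalGap₄ false (I ∷ O ∷ O ∷ O ∷ []) = ([] , l₃ , true) , certified 0x2955535c8a63ef396bde2a21079dc
arrivalGap₄ false (I ∷ O ∷ O ∷ I ∷ []) = ([] , l₂ , false) , certified 0x3dc55d5958f99d11c17150283a338
arrivalGap₄ false (I ∷ O ∷ I ∷ O ∷ []) = ([] , l₂ , true) , certified 0x1541e750717a6c0d0556397355d0c
arrivalGap₄ false (I ∷ O ∷ I ∷ I ∷ []) = ([] , l₅ , true) , certified 0x157ee355306084f44f1e65dc1754c
arrivalGap₄ false (I ∷ I ∷ O ∷ O ∷ []) = ([] , l₃ , true) , certified 0x2955d3548e63ef39ebd62e31079d4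
arrivalGap₄ false (I ∷ I ∷ O ∷ I ∷ []) = ([] , l₃ , true) , certified 0x21ba3cc6987987b5f3af5351c4f54
arrivalGap₄ false (I ∷ I ∷ I ∷ O ∷ []) = ([] , l₃ , false) , certified 0x21cb9a38bc550f2dcc3238419d472
arrivalGap₄ false (I ∷ I ∷ I ∷ I ∷ []) = ([] , l₃ , false) , certified 0x1741f9ca1072ce3585cc5a3a66a62
arrivalGap₄ true  (O ∷ O ∷ O ∷ O ∷ []) = ([] , l₄ , true) , certified 0xbe7738b36a2f3bd73a677d0b0aee
arrivalGap₄ true  (O ∷ O ∷ O ∷ I ∷ []) = ([] , l₃ , false) , certified 0x18c7ce747ef220c60c2157437d430
arrivalGap₄ true  (O ∷ O ∷ I ∷ O ∷ []) = ([] , l₃ , true) , certified 0x3431158d1cd3c8a51757bc6996af4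
arrivalGap₄ true  (O ∷ O ∷ I ∷ I ∷ []) = ([] , l₄ , false) , certified 0x15383ca30f6811eb5e7ad5f63bfd7
arrivalGap₄ true  (O ∷ I ∷ O ∷ O ∷ []) = ([] , l₅ , true) , certified 0xf08f0e09867a7278cef5aeaf30bb
arrivalGap₄ true  (O ∷ I ∷ O ∷ I ∷ []) = ([] , l₁ , true) , certified 0xbaca851a17432d288e9b8f7e617d
arrivalGap₄ true  (O ∷ I ∷ I ∷ O ∷ []) = ([] , l₆ , true) , certified 0xb29e7595752f3ebce7ad322ab3cc
arrivalGap₄ true  (O ∷ I ∷ I ∷ I ∷ []) = ([] , l₁ , false) , certified 0x55985062cd0c55dd1cf57be22bd6
arrivalGap₄ true  (I ∷ O ∷ O ∷ O ∷ []) = ([] , l₁ , false) , certified 0xba61421c60c668f0f055743ef678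
arrivalGap₄ true  (I ∷ O ∷ O ∷ I ∷ []) = ([] , l₃ , true) , certified 0xb34fa82c109ea86a86abc7631a59
arrivalGap₄ true  (I ∷ O ∷ I ∷ O ∷ []) = ([] , l₁ , false) , certified 0xb2e1c55655cb9beb8e0d33e73abb
arrivalGap₄ true  (I ∷ O ∷ I ∷ I ∷ []) = ([] , l₁ , false) , certified 0xb2e1c55655cb9beb8e0d33e73ab3
arrivalGap₄ true  (I ∷ I ∷ O ∷ O ∷ []) = ([] , l₃ , true) , certified 0x33e10c2f7cb31dcf3e7d53561e2f4
arrivalGap₄ true  (I ∷ I ∷ O ∷ I ∷ []) = ([] , l₁ , false) , certified 0xae3a13d8f2a6f8fba29cf9f79cf9
arrivalGap₄ true  (I ∷ I ∷ I ∷ O ∷ []) = ([] , l₃ , true) , certified 0xb34e2e22a33d69c5538eab143333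
arrivalGap₄ true  (I ∷ I ∷ I ∷ I ∷ []) = ([] , l₁ , true) , certified 0xb3d78fb98e70cd1df4f08d773e7c

path₄ : (β : Vec Bool 4) → T (nonzero β) → PathSystem 0 β
path₄ (O ∷ O ∷ O ∷ O ∷ []) ()
path₄ (O ∷ O ∷ O ∷ I ∷ []) _ = certified 0x55e8e0e22a785cf8f20e2c29420eb1
path₄ (O ∷ O ∷ I ∷ O ∷ []) _ = certified 0x3c29e3b8e5ee390e63c8e10758f5cb
path₄ (O ∷ O ∷ I ∷ I ∷ []) _ = certified 0xe3de8d182c863589e89e8671a5761e
path₄ (O ∷ I ∷ O ∷ O ∷ []) _ = certified 0x3a8ba0bd7987615f4f2b5e268f21ee
path₄ (O ∷ I ∷ O ∷ I ∷ []) _ = certified 0x41dd1c355ecaac3c3314a14f0e3d44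
path₄ (O ∷ I ∷ I ∷ O ∷ []) _ = certified 0x184545f0c639830590d39d3bc28534
path₄ (O ∷ I ∷ I ∷ I ∷ []) _ = certified 0xa2286f3ee2cc3caacba8e45630e985
path₄ (I ∷ O ∷ O ∷ O ∷ []) _ = certified 0x7197a98a65a2a7c0cc0ccf55373f3b
path₄ (I ∷ O ∷ O ∷ I ∷ []) _ = certified 0xcf0d332b38b3a2fae682bba2a50d5d
path₄ (I ∷ O ∷ I ∷ O ∷ []) _ = certified 0x41f51e656a8419fb9f8673e3b8f670
path₄ (I ∷ O ∷ I ∷ I ∷ []) _ = certified 0xba3c7d35de34e3cc51a7843dc75ec2
path₄ (I ∷ I ∷ O ∷ O ∷ []) _ = certified 0xbaa2f1f32e10f3158aca711d174314
path₄ (I ∷ I ∷ O ∷ I ∷ []) _ = certified 0x615ef8811c50f4d67047143c5917dc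
path₄ (I ∷ I ∷ I ∷ O ∷ []) _ = certified 0x38d73d472d169973d445558538553d
path₄ (I ∷ I ∷ I ∷ I ∷ []) _ = certified 0xccc2e16668306295d0d38d187d954c

pathGap₄ : (β : Vec Bool 4) → T (nonzero β) → PathGap 0 β
pathGap₄ (O ∷ O ∷ O ∷ O ∷ []) ()
pathGap₄ (O ∷ O ∷ O ∷ I ∷ []) _ = ([] , l₁ , false) , certified 0x60bd9c2151674df5418c38445f544
pathGap₄ (O ∷ O ∷ I ∷ O ∷ []) _ = ([] , l₁ , false) , certified 0x18f18b1cc7d565ce79cb05ddf44d16
pathGap₄ (O ∷ O ∷ I ∷ I ∷ []) _ = ([] , l₁ , false) , certified 0x14c106bc6abb2a999d428c6058538c
pathGap₄ (O ∷ I ∷ O ∷ O ∷ []) _ = ([] , l₁ , false) , certified 0x4615413d358e68c32334669eb4c3d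
pathGap₄ (O ∷ I ∷ O ∷ I ∷ []) _ = ([] , l₁ , false) , certified 0x4b3de87985f657657a3041d61650c
pathGap₄ (O ∷ I ∷ I ∷ O ∷ []) _ = ([] , l₁ , false) , certified 0xb8eb0ee96687d4104ec65a73d970c
pathGap₄ (O ∷ I ∷ I ∷ I ∷ []) _ = ([] , l₃ , false) , certified 0x1a61a3ecc1df86a9a0c2e8aeab5118
pathGap₄ (I ∷ O ∷ O ∷ O ∷ []) _ = ([] , l₁ , false) , certified 0x14c13ce35ca1ba08c2c68757420d0d
pathGap₄ (I ∷ O ∷ O ∷ I ∷ []) _ = ([] , l₁ , false) , certified 0x6782b34e2a7b8a18538538a3107c7
pathGap₄ (I ∷ O ∷ I ∷ O ∷ []) _ = ([] , l₁ , false) , certified 0x18f631434d7d5a61dfaee7c4d5641e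
pathGap₄ (I ∷ O ∷ I ∷ I ∷ []) _ = ([] , l₁ , true) , certified 0xb20b0a33c189a9aa8b1534b39e115
pathGap₄ (I ∷ I ∷ O ∷ O ∷ []) _ = ([] , l₂ , false) , certified 0x13d334739f5533c574371ebce61671
pathGap₄ (I ∷ I ∷ O ∷ I ∷ []) _ = ([] , l₃ , false) , certified 0x51a3dcfcc5f3e6197a668afa24e72
pathGap₄ (I ∷ I ∷ I ∷ O ∷ []) _ = ([] , l₂ , false) , certified 0x3be1e5563df3e9bdc41e198561e28
pathGap₄ (I ∷ I ∷ I ∷ I ∷ []) _ = ([] , l₁ , true) , certified 0x1cf422be3a2f65433bc58911acd77c

-- Induction on the dimension.

detour : (k : ℕ) (o : Anchor k) → DetourSystem o
detourGap : (k : ℕ) (o : Anchor k) → DetourGap o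
-- Flipping the flag exchanges the two pairs, by computation once the flag is known.
detour′ : (k : ℕ) (o : Anchor k) → System (k + 4) ((c₃ o , c₄ o) ∷ []) (c₁ o ∷ c₂ o ∷ [])
extend : (k : ℕ) (i : Fin 3) {s t : V (k + 4)} {ps : Pairs (k + 4)} {ds : List (V (k + 4))} →
         Gap k s t ps ds → System (suc k + 4) ((i ∷ s , i ∷ t) ∷ liftPairs i ps) (map (i ∷_) ds)
extendGap : (k : ℕ) (i : Fin 3) {s t : V (k + 4)} {ps : Pairs (k + 4)} {ds : List (V (k + 4))} →
            Gap k s t ps ds → Gap (suc k) (i ∷ s) (i ∷ t) (liftPairs i ps) (map (i ∷_) ds)

detour zero ([] , l , f) = detour₄ l f
detour (suc k) (i ∷ x , l , f) = extend k i (detourGap k (x , l , f))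

detourGap zero ([] , l , f) = detourGap₄ l f
detourGap (suc k) (i ∷ x , l , f) = extendGap k i (detourGap k (x , l , f))

detour′ k (x , l , false) = detour k (x , l , true)
detour′ k (x , l , true)  = detour k (x , l , false)

extend k i (o , X) = fill i (c₁ o) (c₂ o) (c₃ o) (c₄ o) X (detour k o) (detour′ k o)

extendGap k i (o , X) with detourGap k o
-- The new interruption lies in the detour, hence in copy `next i`.
... | o′@(x , l , f) , Y = (next i ∷ x , l , f) ,
  refill i (c₁ o) (c₂ o) (c₃ o) (c₄ o) (c₁ o′) (c₂ o′) (c₃ o′) (c₄ o′) X Y (detour′ k o)

departureGap : (k : ℕ) → DepartureGap k
departureGap zero = departureGap₄
departureGap (suc k) = extendGap k 0F (departureGap k)

departure : (k : ℕ) → DepartureSystem k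
departure zero = departure₄
departure (suc k) = extend k 0F (departureGap k)

transferGap : (k : ℕ) (h : Bool) → TransferGap k h
transferGap zero h = transferGap₄ h
transferGap (suc k) h = extendGap k 0F (transferGap k h)

transfer : (k : ℕ) (h : Bool) → TransferSystem k h
transfer zero h = transfer₄ h
transfer (suc k) h = extend k 0F (transferGap k h)

crossover : (k : ℕ) (l : Label) {s t : V (k + 4)} {ps : Pairs (k + 4)} {ds : List (V (k + 4))} →
            (let o = home {k} l) →
            System (k + 4) ((s , c₁ o) ∷ (c₂ o , c₃ o) ∷ ps) (c₄ o ∷ ds) →
            System (k + 4) ((c₄ o , t) ∷ (c₁ o , c₂ o) ∷ []) (c₃ o ∷ []) →
            System (suc k + 4) ((0F ∷ s , 1F ∷ t) ∷ liftPairs 0F ps) (map (0F ∷_) ds)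
crossover k l X Y = cross 0F (c₁ o) (c₂ o) (c₃ o) (c₄ o) X Y (detour′ k o)
  where o = home {k} l

-- The start has already been left behind, so every `β` is covered, zero included. A further
-- crossing uses the other tuple, so `h` flips.
arrival : (k : ℕ) (h : Bool) (β : Vec Bool (k + 4)) → ArrivalSystem k h β
arrivalGap : (k : ℕ) (h : Bool) (β : Vec Bool (k + 4)) → ArrivalGap k h β

arrival zero h β = arrival₄ h β
arrival (suc k) h (false ∷ β) = extend k 0F (arrivalGap k h β)
arrival (suc k) h (true ∷ β) = crossover k (side (not h)) (transfer k h) (arrival k (not h) β)

arrivalGap zero h β = arrivalGap₄ h β
arrivalGap (suc k) h (false ∷ β) = extendGap k 0F (arrivalGap k h β)
arrivalGap (suc k) h (true ∷ β) with transferGap k h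
... | (x , l , f) , X = (0F ∷ x , l , f) , crossover k (side (not h)) (rotate X) (arrival k (not h) β)

pathGap : (k : ℕ) (β : Vec Bool (k + 4)) → T (nonzero β) → PathGap k β
pathGap zero β nz = pathGap₄ β nz
pathGap (suc k) (false ∷ β) nz = extendGap k 0F (pathGap k β nz)
pathGap (suc k) (true ∷ β) _ with departureGap k
... | (x , l , f) , X = (0F ∷ x , l , f) , crossover k l₁ (rotate X) (arrival k false β)

path : (k : ℕ) (β : Vec Bool (k + 4)) → T (nonzero β) → PathSystem k β
path zero β nz = path₄ β nz
path (suc k) (false ∷ β) nz = extend k 0F (pathGap k β nz)
path (suc k) (true ∷ β) _ = crossover k l₁ (departure k) (arrival k false β)

-- Transport to arbitrary endpoints by relabelling.

-- A permutation taking 0 to `x` and, if `y` differs from `x`, 1 to `y`. It steps cyclically from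
-- `x`, backwards exactly when `y` is the predecessor of `x`.
relabel₁ : Fin 3 → Fin 3 → Fin 3 → Fin 3
relabel₁ x y 0F = x
relabel₁ x y 1F = turn (does (y ≟ next (next x))) x
relabel₁ x y 2F = turn (does (y ≟ next (next x))) (turn (does (y ≟ next (next x))) x)

relabel₁-injective : ∀ x y {z z′} → relabel₁ x y z ≡ relabel₁ x y z′ → z ≡ z′
relabel₁-injective x y {z} {z′} = toWitness
  {a? = all? λ x → all? λ y → all? λ z → all? λ z′ → (relabel₁ x y z ≟ relabel₁ x y z′) →-dec (z ≟ z′)} tt x y z z′

relabel₁-surjective : ∀ x y z → ∃[ z′ ] relabel₁ x y z′ ≡ z
relabel₁-surjective = toWitness
  {a? = all? λ x → all? λ y → all? λ z → any? λ z′ → relabel₁ x y z′ ≟ z} tt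

bit : Fin 3 → Fin 3 → Bool
bit x y = not (does (x ≟ y))

relabel₁-bit : ∀ x y → relabel₁ x y (if bit x y then 1F else 0F) ≡ y
relabel₁-bit = toWitness {a? = all? λ x → all? λ y → relabel₁ x y (if bit x y then 1F else 0F) ≟ y} tt

relabel : V d → V d → V d → V d
relabel [] [] [] = []
relabel (x ∷ a) (y ∷ b) (z ∷ c) = relabel₁ x y z ∷ relabel a b c

relabel-injective : (a b : V d) → Injective _≡_ _≡_ (relabel a b)
relabel-injective [] [] {[]} {[]} _ = refl
relabel-injective (x ∷ a) (y ∷ b) {_ ∷ _} {_ ∷ _} eq with ∷-injective eq
... | eq₁ , eq₂ = cong₂ _∷_ (relabel₁-injective x y eq₁) (relabel-injective a b eq₂)

relabel-surjective : (a b c : V d) → ∃[ c′ ] relabel a b c′ ≡ c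
relabel-surjective [] [] [] = [] , refl
relabel-surjective (x ∷ a) (y ∷ b) (z ∷ c) with relabel₁-surjective x y z | relabel-surjective a b c
... | z′ , eq₁ | c′ , eq₂ = z′ ∷ c′ , cong₂ _∷_ eq₁ eq₂

lookup-relabel : (a b c : V d) (n : Fin d) → lookup (relabel a b c) n ≡ relabel₁ (lookup a n) (lookup b n) (lookup c n)
lookup-relabel (_ ∷ _) (_ ∷ _) (_ ∷ _) zero = refl
lookup-relabel (_ ∷ a) (_ ∷ b) (_ ∷ c) (suc n) = lookup-relabel a b c n

-- Permuting the symbols of each coordinate separately preserves distinctness and coordinatewise
-- agreement.
relabel-edge : (a b : V d) {u v w : V d} → IsEdge d u v w → IsEdge d (relabel a b u) (relabel a b v) (relabel a b w)
relabel-edge a b {u} {v} {w} (u≢v , v≢w , u≢w , n , agree) =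
  u≢v ∘ relabel-injective a b , v≢w ∘ relabel-injective a b , u≢w ∘ relabel-injective a b , n ,
  λ j j≢n → along u v j (proj₁ (agree j j≢n)) , along v w j (proj₂ (agree j j≢n))
  where
  along : ∀ u v j → lookup u j ≡ lookup v j → lookup (relabel a b u) j ≡ lookup (relabel a b v) j
  along u v j eq = trans (lookup-relabel a b u j) (trans (cong (relabel₁ (lookup a j) (lookup b j)) eq) (sym (lookup-relabel a b v j)))

bits : V d → V d → Vec Bool d
bits = Vec.zipWith bit

relabel-origin : (a b : V d) → relabel a b (origin d) ≡ a
relabel-origin [] [] = refl
relabel-origin (x ∷ a) (y ∷ b) = cong (x ∷_) (relabel-origin a b)

relabel-bits : (a b : V d) → relabel a b (point (bits a b)) ≡ b
relabel-bits [] [] = refl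
relabel-bits (x ∷ a) (y ∷ b) = cong₂ _∷_ (relabel₁-bit x y) (relabel-bits a b)

bits-nonzero : (a b : V d) → a ≢ b → T (nonzero (bits a b))
bits-nonzero [] [] a≢b = contradiction refl a≢b
bits-nonzero (x ∷ a) (y ∷ b) a≢b with x ≟ y
... | yes refl = bits-nonzero a b (a≢b ∘ cong (x ∷_))
... | no _ = tt

connected : (k : ℕ) → LooseHamiltonConnected (k + 4)
connected k a b a≢b with path k (bits a b) (bits-nonzero a b a≢b)
... | system (w ∷ []) full = subst₂ (λ a b → ∃[ ℓ ] Σ (LoosePath _ ℓ) (λ P → start P ≡ a × end P ≡ b × Spanning P))
  (relabel-origin a b) (relabel-bits a b) (fullWalk⇒hamiltonPath (mapWalk f f-edge w) (onto , len))
  where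
  f = relabel a b
  f-edge = relabel-edge a b

  -- The two empty tails come from the one-walk list and the empty list of deleted vertices.
  verts≡ : verts (mapWalk f f-edge w) ≡ map f ((verts w ++ []) ++ [])
  verts≡ = trans (verts-mapWalk f f-edge w) (cong (map f) (sym (trans (++-identityʳ _) (++-identityʳ _))))

  onto : ∀ x → x ∈ verts (mapWalk f f-edge w)
  onto x with relabel-surjective a b x
  ... | y , refl = subst (f y ∈_) (sym verts≡) (∈-map⁺ f (proj₁ full y))

  len : length (verts (mapWalk f f-edge w)) ≡ 3 ^ (k + 4)
  len = trans (cong length verts≡) (trans (length-map f ((verts w ++ []) ++ [])) (proj₂ full))

theorem1p3 : ∀ (d : ℕ) → 4 ≤ d → LooseHamiltonConnected d
theorem1p3 d 4≤d = subst LooseHamiltonConnected (m∸n+n≡m 4≤d) (connected (d ∸ 4))
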